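{- Let $q,n,m\ge 2$ be integers and $M=q(m-1)+1$. There exists an edge-labeled graph $G$ with labels in $[M]=\{1,\dots,M\}$ such that, for every $q$-coloring of the edges of $G$, there is a set $S$ of $m$ distinct labels and a color $c$ such that, for every edge-labeling of the complete graph $K_n$ with labels in $S$, $G$ contains a copy of this edge-labeled $K_n$ all of whose edges have color $c$. In particular, taking $m=\binom{n}{2}$, $G$ contains a copy, monochromatic in color $c$, of every edge-ordered graph with possibly repeated labels on $n$ vertices.
   Context: An edge-labeled graph is a graph in which every edge is assigned a label (labels need not be distinct and need not be ordered). For edge-labeled graphs $G$ and $H$, $G$ contains a copy of $H$ if there is a subgraph of $G$ with an isomorphism to $H$ preserving the edge labels. An edge-ordered graph with possibly repeated labels is a graph whose edges are assigned integer labels (not necessarily distinct); two such graphs are equivalent if there is an isomorphism between them preserving the ordering of the labels (in particular equally labeled edges map to equally labeled edges), and a copy of such an $H$ in an edge-labeled graph $G$ with integer labels means a subgraph equivalent to $H$. -}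

module Defs where

open import Data.Nat using (ℕ; _+_; _*_; _∸_; _≤_)
open import Data.Fin using (Fin; toℕ)
open import Data.Fin.Subset using (Subset; _∈_; ∣_∣)
open import Data.Maybe using (Maybe; just; nothing)
open import Data.Integer as ℤ using (ℤ)
open import Data.Product using (Σ; _×_; ∃; ∃-syntax)
open import Function.Bundles using (_⇔_)
open import Function.Definitions using (Injective)
open import Relation.Binary.PropositionalEquality using (_≡_; _≢_)

-- A finite edge-labeled (simple, undirected) graph with labels in L:
-- vertex set Fin N; lab u v = just a  iff  uv is an edge with label a.
record LGraph (L : Set) : Set where
  field
    N          : ℕ
    lab        : Fin N → Fin N → Maybe L
    lab-sym    : ∀ u v → lab u v ≡ lab v u
    lab-irrefl : ∀ u → lab u u ≡ nothing
open LGraph public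

-- A q-colouring of the edges of G (given as a symmetric function on vertex pairs;
-- only its values on edges matter).
Colouring : ∀ {L} → LGraph L → ℕ → Set
Colouring G q = Σ (Fin (N G) → Fin (N G) → Fin q) λ χ → ∀ u v → χ u v ≡ χ v u

KLabelling : (n M : ℕ) → Subset M → Set
KLabelling n M S =
  Σ (Fin n → Fin n → Fin M) λ ℓ →
    (∀ i j → ℓ i j ≡ ℓ j i) × (∀ i j → i ≢ j → ℓ i j ∈ S)

MonoLabeledCopy : ∀ {n M q} (G : LGraph (Fin M)) → (Fin (N G) → Fin (N G) → Fin q) →
                  Fin q → (Fin n → Fin n → Fin M) → Set
MonoLabeledCopy {n} G χ c ℓ =
  Σ (Fin n → Fin (N G)) λ f → Injective _≡_ _≡_ f ×
    (∀ i j → i ≢ j → (lab G (f i) (f j) ≡ just (ℓ i j)) × (χ (f i) (f j) ≡ c))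

record EOGraph (n : ℕ) : Set where
  field
    hlab        : Fin n → Fin n → Maybe ℤ
    hlab-sym    : ∀ i j → hlab i j ≡ hlab j i
    hlab-irrefl : ∀ i → hlab i i ≡ nothing
open EOGraph public

-- G contains a copy of H (a subgraph equivalent to H: injective vertex map sending
-- edges to edges and preserving the order (hence also equality) of labels),
-- all of whose edges have colour c.
MonoOrderedCopy : ∀ {n M q} (G : LGraph (Fin M)) → (Fin (N G) → Fin (N G) → Fin q) →
                  Fin q → EOGraph n → Set
MonoOrderedCopy {n} G χ c H =
  Σ (Fin n → Fin (N G)) λ f → Injective _≡_ _≡_ f ×
    ((∀ i j a → hlab H i j ≡ just a →
        (∃[ b ] lab G (f i) (f j) ≡ just b) × (χ (f i) (f j) ≡ c)) ×
     (∀ i j i′ j′ a a′ b b′ →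
        hlab H i j ≡ just a → hlab H i′ j′ ≡ just a′ →
        lab G (f i) (f j) ≡ just b → lab G (f i′) (f j′) ≡ just b′ →
        (a ℤ.≤ a′) ⇔ (toℕ b ≤ toℕ b′)))

{-# OPTIONS --safe #-}
-- By pigeonhole on the labels it is enough to find G such that, in every q-colouring, the colour
-- is a function of the label on a family of copies realising all labellings of K_n.  This is the
-- partite construction: start with the disjoint union of all labellings of a large K_r, seen as
-- an r-partite graph, and, for each pair of parts and each label, amalgamate along the combinatorial
-- lines of a Hales–Jewett cube, so that the colour of an edge depends only on its label and its
-- two parts.  Ramsey's theorem for pairs of parts, coloured by functions from labels to colours,
-- then removes the dependence on the parts.  For the ordered version, an integer label is replaced
-- by the number of edges with a smaller label, which is less than n C 2.
module Submission where

open import Defs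
open import Data.Nat using (ℕ; zero; suc; _+_; _*_; _∸_; _^_; _≤_; _<_; _<?_; z≤n; s≤s; s<s)
open import Data.Nat.Combinatorics using (_C_; nC1≡n; nCk+nC[k+1]≡[n+1]C[k+1])
import Data.Nat.Properties as ℕ
open import Data.Integer as ℤ using (ℤ)
import Data.Integer.Properties as ℤ
open import Data.Fin as F using (Fin; zero; suc; toℕ; fromℕ<; finToFun; funToFin; _↑ˡ_; _↑ʳ_)
open import Data.Fin.Properties
  using (_≟_; any?; toℕ<n; toℕ-fromℕ<; toℕ-injective; finToFun-funToFin; pigeonhole; *↔×; +↔⊎)
open import Data.Fin.Subset using (Subset; ∣_∣; inside; outside; _∈_; _⊆_; ⊤)
open import Data.Fin.Subset.Properties using (∣⊤∣≡n)
open import Data.Maybe using (Maybe; just; nothing)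
open import Data.Maybe.Properties using (just-injective)
import Data.Maybe.Relation.Unary.Any as Maybe
open import Data.Vec using (Vec; []; _∷_; _++_; map; lookup; tabulate; uncons; here; there)
open import Data.Vec.Properties
  using (map-∘; map-cong; map-++; lookup-map; lookup-++ˡ; lookup-++ʳ; lookup∘tabulate; tabulate∘lookup;
         tabulate-cong; tabulate-∘)
open import Data.Vec.Relation.Binary.Pointwise.Inductive as Pointwise using (Pointwise; []; _∷_)
open import Data.List as List using (List; []; _∷_; allFin; cartesianProduct; filter; length)
open import Data.List.Properties using (length-++; length-map; length-tabulate; filter-notAll)
open import Data.List.Membership.Propositional using (lose) renaming (_∈_ to _∈ₗ_)
open import Data.List.Membership.Propositional.Properties
  using (∈-allFin; ∈-map⁺; ∈-++⁺ˡ; ∈-++⁺ʳ; ∈-cartesianProduct⁺)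
open import Data.List.Relation.Unary.Any using (here; there)
open import Data.Product using (Σ; Σ-syntax; _×_; ∃; ∃-syntax; ∃₂; _,_; proj₁; proj₂)
open import Data.Product.Function.NonDependent.Propositional using (_×-↔_)
open import Data.Sum as Sum using (_⊎_; inj₁; inj₂; [_,_]′)
open import Data.Sum.Function.Propositional using (_⊎-↔_)
open import Data.Sum.Properties using (inj₁-injective; inj₂-injective)
open import Function using (_∘_; id; const; _↔_; _⇔_; mk↔ₛ′; mk⇔; Inverse)
open import Function.Definitions using (Injective)
open import Function.Properties.Inverse using (↔-refl; ↔-sym; ↔-trans)
open import Relation.Nullary using (Dec; yes; no; contradiction; ¬_; ¬?; map′; _×-dec_; _⊎-dec_)
open import Relation.Binary.Definitions using (tri<; tri≈; tri>)
open import Relation.Binary.PropositionalEquality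
  using (_≡_; _≢_; _≗_; refl; sym; trans; cong; cong₂; subst; subst₂)

-- The Hales–Jewett theorem

-- A point of a j-dimensional combinatorial subspace of Vec A N is obtained by filling
-- the j kinds of moving coordinates of a template in Vec (A ⊎ Fin j) N.
fill : ∀ {A : Set} {j N} → Vec A j → Vec (A ⊎ Fin j) N → Vec A N
fill w = map [ id , lookup w ]′

_⟨_⟩ : ∀ {A : Set} {N} → Vec (A ⊎ Fin 1) N → A → Vec A N
L ⟨ a ⟩ = fill (a ∷ []) L

-- A subspace `l` of the parameters of `Φ` is itself a subspace of the ambient cube: constants of
-- `Φ` stay, and a coordinate of kind `y` becomes `lookup l y`.
fill-∘ : ∀ {A : Set} {i j N} (w : Vec A i) (l : Vec (A ⊎ Fin i) j) (Φ : Vec (A ⊎ Fin j) N) →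
  fill w (map [ inj₁ , lookup l ]′ Φ) ≡ fill (fill w l) Φ
fill-∘ w l Φ = trans (sym (map-∘ _ _ Φ)) (map-cong eq Φ)
  where
  eq : ∀ z → [ id , lookup w ]′ ([ inj₁ , lookup l ]′ z) ≡ [ id , lookup (fill w l) ]′ z
  eq (inj₁ a) = refl
  eq (inj₂ y) = sym (lookup-map y _ l)

encode : ∀ {s N} → Vec (Fin s) N → Fin (s ^ N)
encode v = funToFin (lookup v)

decode : ∀ {s N} → Fin (s ^ N) → Vec (Fin s) N
decode i = tabulate (finToFun i)

decode∘encode : ∀ {s N} (v : Vec (Fin s) N) → decode {s} {N} (encode v) ≡ v
decode∘encode v = trans (tabulate-cong (finToFun-funToFin (lookup v))) (tabulate∘lookup v)

funToFin-injective : ∀ {m n} {f g : Fin m → Fin n} → funToFin f ≡ funToFin g → ∀ i → f i ≡ g i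
funToFin-injective {f = f} {g} eq i =
  trans (sym (finToFun-funToFin f i)) (trans (cong (λ k → finToFun k i) eq) (finToFun-funToFin g i))

-- Codes a whole colouring of a cube as a single colour; equal codes give pointwise equal
-- colourings.
table : ∀ {s N q} → (Vec (Fin s) N → Fin q) → Fin (q ^ (s ^ N))
table {s} {N} f = funToFin (λ i → f (decode {s} {N} i))

table-injective : ∀ {s N q} {f g : Vec (Fin s) N → Fin q} → table f ≡ table g → ∀ v → f v ≡ g v
table-injective {f = f} {g} eq v =
  subst (λ u → f u ≡ g u) (decode∘encode v) (funToFin-injective eq (encode v))

-- The number of colours is quantified inside, because the induction on the alphabet calls the
-- smaller case with far more colours. A template may be constant, so the moving coordinate is
-- asserted separately.
HalesJewett : ℕ → Set
HalesJewett s = ∀ q → ∃[ N ] ∀ (χ : Vec (Fin s) N → Fin q) →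
  ∃[ L ] (∃[ x ] lookup L x ≡ inj₂ zero) × (∀ a b → χ (L ⟨ a ⟩) ≡ χ (L ⟨ b ⟩))

-- The letter zero is the one added to an alphabet of s old letters.
data _≈_ {s} : Fin (suc s) → Fin (suc s) → Set where
  same : ∀ {a} → a ≈ a
  old  : ∀ {a b} → suc a ≈ suc b

-- Induction on `j`: a line in a last block of `B` coordinates supplies the new kind, and the first
-- `A` coordinates supply the other `j`. The line is chosen against all words of the first block at
-- once, then the subspace against all letters on that line.
insensitiveSubspace : ∀ {s} → HalesJewett s → ∀ j q → ∃[ N ]
  ∀ (χ : Vec (Fin (suc s)) N → Fin q) → ∃[ Φ ]
    (∀ (y : Fin j) → ∃[ x ] lookup Φ x ≡ inj₂ y) ×
    (∀ {v w} → Pointwise _≈_ v w → χ (fill v Φ) ≡ χ (fill w Φ))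
insensitiveSubspace hj zero q = 0 , λ χ → [] , (λ ()) , λ _ → refl
insensitiveSubspace {s} hj (suc j) q
  with A , subA ← insensitiveSubspace hj j (q ^ suc s)
  with B , lineB ← hj (q ^ (suc s ^ A)) = A + B , go
  where
  go : ∀ (χ : Vec (Fin (suc s)) (A + B) → Fin q) → ∃[ Φ ]
    (∀ (y : Fin (suc j)) → ∃[ x ] lookup Φ x ≡ inj₂ y) ×
    (∀ {v w} → Pointwise _≈_ v w → χ (fill v Φ) ≡ χ (fill w Φ))
  go χ
    -- The colour of an old word is the entire colouring it induces on the first block; along `L₀`
    -- that induced colouring is constant.
    with L₀ , (x₀ , move₀) , mono ←
           lineB (λ v → table {suc s} {A} (λ u → χ (u ++ map suc v)))
    -- The line is now fixed; a word `u` is coloured by a function of the letter `b` put on it,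
    -- `zero` included.
    with Φ , moveA , insA ←
           subA (λ u → funToFin {suc s} (λ b → χ (u ++ map (Sum.map₁ suc) L₀ ⟨ b ⟩)))
    = Ψ , moves , insensitive
    where
    L : Vec (Fin (suc s) ⊎ Fin 1) B
    L = map (Sum.map₁ suc) L₀
    Ψ : Vec (Fin (suc s) ⊎ Fin (suc j)) (A + B)
    Ψ = map (Sum.map₂ suc) Φ ++ map (Sum.map₂ (const zero)) L
    fill-Ψ : ∀ b w → fill (b ∷ w) Ψ ≡ fill w Φ ++ L ⟨ b ⟩
    fill-Ψ b w = trans (map-++ _ (map (Sum.map₂ suc) Φ) _)
      (cong₂ _++_
        (trans (sym (map-∘ _ _ Φ)) (map-cong (λ { (inj₁ _) → refl ; (inj₂ _) → refl }) Φ))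
        (trans (sym (map-∘ _ _ L)) (map-cong (λ { (inj₁ _) → refl ; (inj₂ zero) → refl }) L)))
    L-old : ∀ a → L ⟨ suc a ⟩ ≡ map suc (L₀ ⟨ a ⟩)
    L-old a = trans (sym (map-∘ _ _ L₀))
      (trans (map-cong (λ { (inj₁ _) → refl ; (inj₂ zero) → refl }) L₀) (map-∘ _ _ L₀))
    moves : ∀ y → ∃[ x ] lookup Ψ x ≡ inj₂ y
    moves zero = A ↑ʳ x₀ , trans (lookup-++ʳ (map (Sum.map₂ suc) Φ) _ x₀)
      (trans (lookup-map x₀ _ L) (cong (Sum.map₂ (const zero))
        (trans (lookup-map x₀ _ L₀) (cong (Sum.map₁ suc) move₀))))
    moves (suc y) with x , eq ← moveA y = x ↑ˡ B ,
      trans (lookup-++ˡ (map (Sum.map₂ suc) Φ) _ x) (trans (lookup-map x _ Φ) (cong (Sum.map₂ suc) eq))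
    head-≈ : ∀ {a b} → a ≈ b → ∀ (u : Vec (Fin (suc s)) A) → χ (u ++ L ⟨ a ⟩) ≡ χ (u ++ L ⟨ b ⟩)
    head-≈ same u = refl
    head-≈ (old {a} {b}) u
      rewrite L-old a | L-old b = table-injective (mono a b) u
    insensitive : ∀ {v w} → Pointwise _≈_ v w → χ (fill v Ψ) ≡ χ (fill w Ψ)
    insensitive {a ∷ v} {b ∷ w} (a≈b ∷ v≈w) rewrite fill-Ψ a v | fill-Ψ b w =
      trans (head-≈ a≈b (fill v Φ)) (funToFin-injective
        {f = λ b → χ (fill v Φ ++ L ⟨ b ⟩)} {g = λ b → χ (fill w Φ ++ L ⟨ b ⟩)} (insA v≈w) b)

-- Among the q + 1 words 0ᵏ1^(q−k) of an insensitive q-dimensional subspace two have the same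
-- colour; on the line 0ᵏ∗^(l−k)1^(q−l) joining them the old letters are indistinguishable from 1.
hales-jewett-suc : ∀ {s} → HalesJewett (suc s) → HalesJewett (suc (suc s))
hales-jewett-suc {s} hj q with N , sub ← insensitiveSubspace hj q q = N , go
  where
  step : ∀ {k i} → Dec (i < k) → Fin (suc (suc s))
  step (yes _) = zero
  step (no  _) = suc zero
  point : Fin (suc q) → Vec (Fin (suc (suc s))) q
  point k = tabulate (λ i → step (toℕ i <? toℕ k))
  slot : ∀ {k l i} → Dec (i < k) → Dec (i < l) → Fin (suc (suc s)) ⊎ Fin 1
  slot (yes _) _       = inj₁ zero
  slot (no  _) (yes _) = inj₂ zero
  slot (no  _) (no  _) = inj₁ (suc zero)
  slot-moves : ∀ {k l i} (k? : Dec (i < k)) (l? : Dec (i < l)) → ¬ i < k → i < l → slot k? l? ≡ inj₂ zero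
  slot-moves (yes i<k) _         i≮k i<l = contradiction i<k i≮k
  slot-moves (no  _)   (yes _)   i≮k i<l = refl
  slot-moves (no  _)   (no  i≮l) i≮k i<l = contradiction i<l i≮l
  slot-new : ∀ {k l i} (k? : Dec (i < k)) (l? : Dec (i < l)) → k < l →
    [ id , lookup (zero ∷ []) ]′ (slot k? l?) ≈ step l?
  slot-new (yes _)   (yes _)   k<l = same
  slot-new (yes i<k) (no  i≮l) k<l = contradiction (ℕ.<-trans i<k k<l) i≮l
  slot-new (no  _)   (yes _)   k<l = same
  slot-new (no  _)   (no  _)   k<l = same
  slot-old : ∀ {k l i} a (k? : Dec (i < k)) (l? : Dec (i < l)) →
    [ id , lookup (suc a ∷ []) ]′ (slot k? l?) ≈ step k?
  slot-old a (yes _) _       = same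
  slot-old a (no  _) (yes _) = old
  slot-old a (no  _) (no  _) = same
  go : ∀ (χ : Vec (Fin (suc (suc s))) N → Fin q) →
    ∃[ L ] (∃[ x ] lookup L x ≡ inj₂ zero) × (∀ a b → χ (L ⟨ a ⟩) ≡ χ (L ⟨ b ⟩))
  go χ with Φ , moves , ins ← sub χ
       with k , l , k<l , same-colour ← pigeonhole ℕ.≤-refl (λ k → χ (fill (point k) Φ))
    = map [ inj₁ , lookup line ]′ Φ , (x , move) , λ a b → trans (colour a) (sym (colour b))
    where
    slot-at : Fin q → Fin (suc (suc s)) ⊎ Fin 1
    slot-at i = slot (toℕ i <? toℕ k) (toℕ i <? toℕ l)
    line : Vec (Fin (suc (suc s)) ⊎ Fin 1) q
    line = tabulate slot-at
    -- From `k < l ≤ q`: position `k` is on the moving stretch of the line, so a coordinate of that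
    -- kind of `Φ` moves in the composite.
    k<q : toℕ k < q
    k<q = ℕ.<-≤-trans k<l (ℕ.≤-pred (toℕ<n l))
    y : Fin q
    y = fromℕ< k<q
    y≡k : toℕ y ≡ toℕ k
    y≡k = toℕ-fromℕ< k<q
    x : Fin N
    x = proj₁ (moves y)
    move : lookup (map [ inj₁ , lookup line ]′ Φ) x ≡ inj₂ zero
    move = trans (lookup-map x _ Φ) (trans (cong [ inj₁ , lookup line ]′ (proj₂ (moves y)))
      (trans (lookup∘tabulate slot-at y)
        (slot-moves (toℕ y <? toℕ k) (toℕ y <? toℕ l)
          (ℕ.<-irrefl y≡k) (subst (_< toℕ l) (sym y≡k) k<l))))
    line-point : ∀ {a m} → (∀ i → [ id , lookup (a ∷ []) ]′ (slot-at i) ≈ step (toℕ i <? toℕ m)) →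
      Pointwise _≈_ (line ⟨ a ⟩) (point m)
    line-point slot≈ = subst (λ v → Pointwise _≈_ v _) (tabulate-∘ _ slot-at) (Pointwise.tabulate⁺ slot≈)
    colour : ∀ a → χ (map [ inj₁ , lookup line ]′ Φ ⟨ a ⟩) ≡ χ (fill (point k) Φ)
    colour a rewrite fill-∘ (a ∷ []) line Φ with a
    -- The letter `zero` gives `point l`; an old letter gives `point k` up to `_≈_`.
    ... | zero  = trans
      (ins (line-point {m = l} (λ i → slot-new (toℕ i <? toℕ k) (toℕ i <? toℕ l) k<l))) (sym same-colour)
    ... | suc a = ins (line-point {m = k} (λ i → slot-old a (toℕ i <? toℕ k) (toℕ i <? toℕ l)))

-- The step takes its letter 1 from the old alphabet, so the induction starts at one letter; up to
-- one letter, a single moving coordinate suffices.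
hales-jewett : ∀ s → HalesJewett s
hales-jewett zero          q = 1 , λ χ → inj₂ zero ∷ [] , (zero , refl) , λ ()
hales-jewett (suc zero)    q = 1 , λ χ → inj₂ zero ∷ [] , (zero , refl) , λ { zero zero → refl }
hales-jewett (suc (suc s)) q = hales-jewett-suc (hales-jewett (suc s)) q

-- Finite Ramsey theory

StrictMono : ∀ {m n} → (Fin m → Fin n) → Set
StrictMono e = ∀ {i j} → i F.< j → e i F.< e j

strictMono⇒≢ : ∀ {m n} {e : Fin m → Fin n} → StrictMono e → ∀ {i j} → i ≢ j → e i ≢ e j
strictMono⇒≢ mono {i} {j} i≢j eq with ℕ.<-cmp (toℕ i) (toℕ j)
... | tri< i<j _ _ = ℕ.<-irrefl (cong toℕ eq) (mono i<j)
... | tri≈ _ i≡j _ = i≢j (toℕ-injective i≡j)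
... | tri> _ _ j<i = ℕ.<-irrefl (cong toℕ (sym eq)) (mono j<i)

enumerate : ∀ {n} (S : Subset n) → ∃[ e ] StrictMono {∣ S ∣} {n} e × (∀ i → e i ∈ S)
enumerate [] = (λ ()) , (λ { {()} }) , λ ()
enumerate (outside ∷ S) with e , mono , e∈S ← enumerate S = suc ∘ e , s<s ∘ mono , there ∘ e∈S
enumerate {suc n} (inside ∷ S) with e , mono , e∈S ← enumerate S = e′ , mono′ , e′∈S
  where
  e′ : Fin (suc ∣ S ∣) → Fin (suc n)
  e′ zero    = zero
  e′ (suc i) = suc (e i)
  mono′ : StrictMono e′
  mono′ {zero}  {suc j} _         = s≤s z≤n
  mono′ {suc i} {suc j} (s≤s i<j) = s<s (mono i<j)
  e′∈S : ∀ i → e′ i ∈ inside ∷ S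
  e′∈S zero    = here
  e′∈S (suc i) = there (e∈S i)

subsetOfSize : ∀ {n} k (D : Subset n) → k ≤ ∣ D ∣ → ∃[ S ] ∣ S ∣ ≡ k × S ⊆ D
subsetOfSize zero    []            _ = [] , refl , id
subsetOfSize k       (outside ∷ D) k≤∣D∣ with S , size , S⊆D ← subsetOfSize k D k≤∣D∣ =
  outside ∷ S , size , λ { (there a∈S) → there (S⊆D a∈S) }
subsetOfSize zero    (inside ∷ D)  _ with S , size , S⊆D ← subsetOfSize zero D z≤n =
  outside ∷ S , size , λ { (there a∈S) → there (S⊆D a∈S) }
subsetOfSize (suc k) (inside ∷ D)  (s≤s k≤∣D∣) with S , size , S⊆D ← subsetOfSize k D k≤∣D∣ =
  inside ∷ S , cong suc size , λ { here → here ; (there a∈S) → there (S⊆D a∈S) }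

splitSubset : ∀ {n} {P : Fin n → Set} (P? : ∀ a → Dec (P a)) (D : Subset n) →
  ∃₂ λ S T → (∣ D ∣ ≡ ∣ S ∣ + ∣ T ∣) × (∀ {a} → a ∈ S → a ∈ D × P a) × (∀ {a} → a ∈ T → a ∈ D × ¬ P a)
splitSubset P? [] = [] , [] , refl , (λ ()) , λ ()
splitSubset P? (d ∷ D)
  with S , T , size , inS , inT ← splitSubset (P? ∘ suc) D
  with d | P? zero
... | outside | _ = outside ∷ S , outside ∷ T , size ,
  (λ { (there a∈S) → let a∈D , p = inS a∈S in there a∈D , p }) ,
  (λ { (there a∈T) → let a∈D , p = inT a∈T in there a∈D , p })
... | inside | yes p = inside ∷ S , outside ∷ T , cong suc size ,
  (λ { here → here , p ; (there a∈S) → let a∈D , p = inS a∈S in there a∈D , p }) ,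
  (λ { (there a∈T) → let a∈D , p = inT a∈T in there a∈D , p })
... | inside | no ¬p = outside ∷ S , inside ∷ T , trans (cong suc size) (sym (ℕ.+-suc _ _)) ,
  (λ { (there a∈S) → let a∈D , p = inS a∈S in there a∈D , p }) ,
  (λ { here → here , ¬p ; (there a∈T) → let a∈D , p = inT a∈T in there a∈D , p })

-- Induction on the number of values: if the class of the largest value has at most `k` elements,
-- removing it leaves more than `q * k` elements and one value fewer. Values are naturals so that
-- the bound can drop.
pigeonhole-within : ∀ {n} q k (f : Fin n → ℕ) (D : Subset n) → (∀ {a} → a ∈ D → f a < q) →
  q * k < ∣ D ∣ → ∃[ S ] ∣ S ∣ ≡ suc k × (∀ {a b} → a ∈ S → b ∈ S → f a ≡ f b)
pigeonhole-within zero k f D f<q 0<∣D∣ with S , size , S⊆D ← subsetOfSize 1 D 0<∣D∣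
  with e , _ , e∈S ← enumerate S = contradiction (f<q (S⊆D (e∈S (subst Fin (sym size) zero)))) λ ()
pigeonhole-within (suc q) k f D f<q q*k<∣D∣
  with A , B , size , inA , inB ← splitSubset (λ a → f a ℕ.≟ q) D
  with k <? ∣ A ∣
... | yes k<∣A∣ with S , ∣S∣≡k , S⊆A ← subsetOfSize (suc k) A k<∣A∣ =
  S , ∣S∣≡k , λ a∈S b∈S → trans (proj₂ (inA (S⊆A a∈S))) (sym (proj₂ (inA (S⊆A b∈S))))
... | no k≮∣A∣ = pigeonhole-within q k f B
  (λ a∈B → let a∈D , f≢q = inB a∈B in ℕ.≤∧≢⇒< (ℕ.≤-pred (f<q a∈D)) f≢q)
  (ℕ.+-cancelˡ-< ∣ A ∣ _ _ (ℕ.<-≤-trans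
    (ℕ.≤-<-trans (ℕ.+-monoˡ-≤ _ (ℕ.≮⇒≥ k≮∣A∣)) q*k<∣D∣) (ℕ.≤-reflexive size)))

pigeonhole-subset : ∀ {n q} k (f : Fin n → Fin q) → q * k < n →
  ∃[ S ] ∣ S ∣ ≡ suc k × ∃[ c ] (∀ {a} → a ∈ S → f a ≡ c)
pigeonhole-subset {n} {q} k f q*k<n
  with S , size , const-on-S ← pigeonhole-within q k (toℕ ∘ f) ⊤ (λ {a} _ → toℕ<n (f a))
         (subst (q * k <_) (sym (∣⊤∣≡n n)) q*k<n)
  with e , _ , e∈S ← enumerate S
  = S , size , f a₀ , λ a∈S → toℕ-injective (const-on-S a∈S (e∈S _))
  where
  -- `S` has `suc k` elements, so one exists to name the colour.
  a₀ : Fin n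
  a₀ = e (subst Fin (sym size) zero)

pigeonhole-mono : ∀ {n q} k (f : Fin n → Fin q) → q * k < n →
  ∃[ e ] StrictMono {suc k} e × ∃[ c ] (∀ i → f (e i) ≡ c)
pigeonhole-mono k f q*k<n
  with S , size , c , eq ← pigeonhole-subset k f q*k<n
  with e , mono , e∈S ← enumerate S
  rewrite size = e , mono , c , λ i → eq (e∈S i)

-- The Erdős-Rado argument: take vertex `zero`, keep `suc N` of the other `suc (K * N)` vertices,
-- all joined to it in one colour, and recurse among them.
endHomogeneous : ∀ K k → ∃[ N ] ∀ (χ : Fin (suc N) → Fin (suc N) → Fin K) →
  ∃[ v ] StrictMono {k} v × Σ[ col ∈ (Fin k → Fin K) ] (∀ {i j} → i F.< j → χ (v i) (v j) ≡ col i)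
endHomogeneous K zero = 0 , λ χ → (λ ()) , (λ { {()} }) , (λ ()) , λ { {()} }
endHomogeneous K (suc k) with N , ih ← endHomogeneous K k = suc (K * N) , go
  where
  go : ∀ (χ : Fin (suc (suc (K * N))) → Fin (suc (suc (K * N))) → Fin K) →
    ∃[ v ] StrictMono {suc k} v × Σ[ col ∈ (Fin (suc k) → Fin K) ]
      (∀ {i j} → i F.< j → χ (v i) (v j) ≡ col i)
  go χ
    with e , e-mono , c , χ≡c ← pigeonhole-mono N (χ zero ∘ suc) ℕ.≤-refl
    with v , v-mono , col , χ≡col ← ih (λ x y → χ (suc (e x)) (suc (e y)))
    = v′ , mono , col′ , homogeneous
    where
    v′ : Fin (suc k) → Fin (suc (suc (K * N)))
    v′ zero    = zero
    v′ (suc i) = suc (e (v i))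
    col′ : Fin (suc k) → Fin K
    col′ zero    = c
    col′ (suc i) = col i
    mono : StrictMono v′
    mono {zero}  {suc j} _         = s≤s z≤n
    mono {suc i} {suc j} (s≤s i<j) = s<s (e-mono (v-mono i<j))
    homogeneous : ∀ {i j} → i F.< j → χ (v′ i) (v′ j) ≡ col′ i
    homogeneous {zero}  {suc j} _         = χ≡c (v j)
    homogeneous {suc i} {suc j} (s≤s i<j) = χ≡col i<j

abstract

  -- Among `suc (K * n)` terms of an end-homogeneous sequence, `suc n` have the same value of `col`.
  ramsey : ∀ K n → ∃[ N ] ∀ (χ : Fin (suc N) → Fin (suc N) → Fin K) →
    ∃[ g ] StrictMono {suc n} g × ∃[ c ] (∀ {i j} → i F.< j → χ (g i) (g j) ≡ c)
  ramsey K n with N , endHom ← endHomogeneous K (suc (K * n)) = N , go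
    where
    go : ∀ (χ : Fin (suc N) → Fin (suc N) → Fin K) →
      ∃[ g ] StrictMono {suc n} g × ∃[ c ] (∀ {i j} → i F.< j → χ (g i) (g j) ≡ c)
    go χ
      with v , v-mono , col , χ≡col ← endHom χ
      with e , e-mono , c , col≡c ← pigeonhole-mono n col ℕ.≤-refl
      = v ∘ e , v-mono ∘ e-mono , c , λ {i} i<j → trans (χ≡col (e-mono i<j)) (col≡c i)

-- The partite construction

Finite : Set → Set
Finite A = ∃[ n ] A ↔ Fin n

abstract

  ×-finite : ∀ {A B} → Finite A → Finite B → Finite (A × B)
  ×-finite (_ , f) (_ , g) = _ , ↔-trans (f ×-↔ g) (↔-sym *↔×)

  ⊎-finite : ∀ {A B} → Finite A → Finite B → Finite (A ⊎ B)
  ⊎-finite (_ , f) (_ , g) = _ , ↔-trans (f ⊎-↔ g) (↔-sym +↔⊎)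

  Vec-finite : ∀ {A} n → Finite A → Finite (Vec A n)
  Vec-finite zero    _ = 1 , mk↔ₛ′ (λ _ → zero) (λ _ → []) (λ { zero → refl }) (λ { [] → refl })
  Vec-finite (suc n) f with m , g ← ×-finite f (Vec-finite n f) = m , ↔-trans
    (mk↔ₛ′ uncons (λ (x , xs) → x ∷ xs) (λ _ → refl) (λ { (_ ∷ _) → refl })) g

  search : ∀ {A : Set} {P : A → Set} → Finite A → (∀ x → Dec (P x)) → Dec (∃ P)
  search {P = P} (_ , f) P? = map′ (λ (i , p) → from i , p)
    (λ (x , p) → to x , subst P (sym (strictlyInverseʳ x)) p) (any? (P? ∘ from))
    where open Inverse f

  finite⇒≟ : ∀ {A : Set} → Finite A → (x y : A) → Dec (x ≡ y)
  finite⇒≟ (_ , f) x y = map′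
    (λ eq → trans (sym (strictlyInverseʳ x)) (trans (cong from eq) (strictlyInverseʳ y)))
    (cong to) (to x ≟ to y)
    where open Inverse f

-- An r-partite labelled graph presented as a union of complete transversals ("copies"): copy s
-- meets part k in vertex k s, and copies may share vertices.  Pairs of vertices
-- contained in no copy are not edges.
record System (r M : ℕ) : Set₁ where
  field
    Copy Vertex   : Set
    copyFinite    : Finite Copy
    vertexFinite  : Finite Vertex
    vertex        : Fin r → Copy → Vertex
    label         : Copy → Fin r → Fin r → Fin M
    label-sym     : ∀ s i j → label s i j ≡ label s j i
    consistent    : ∀ {s t k l} → k ≢ l → vertex k s ≡ vertex k t → vertex l s ≡ vertex l t →
                    label s k l ≡ label t k l

open System

-- `vert` takes the part as an argument because all parts share the type `Vertex`: an actual vertex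
-- is a part together with an element.
record _⟶_ {r M} (P Q : System r M) : Set where
  field
    copy         : Copy P → Copy Q
    vert         : Fin r → Vertex P → Vertex Q
    vertex-copy  : ∀ k s → vertex Q k (copy s) ≡ vert k (vertex P k s)
    label-copy   : ∀ s i j → label Q (copy s) i j ≡ label P s i j

open _⟶_

PairColouring : ∀ {r M} → System r M → ℕ → Set
PairColouring {r} P q = Fin r → Fin r → Vertex P → Vertex P → Fin q

edgeColour : ∀ {r M q} (P : System r M) → PairColouring P q → Copy P → Fin r → Fin r → Fin q
edgeColour P χ s i j = χ i j (vertex P i s) (vertex P j s)

pullback : ∀ {r M q} {P Q : System r M} → P ⟶ Q → PairColouring Q q → PairColouring P q
pullback φ χ i j u v = χ i j (vert φ i u) (vert φ j v)

LabelDetermines : ∀ {r M q} (P : System r M) → PairColouring P q → Fin r → Fin r → Fin M → Set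
LabelDetermines P χ i j a = ∀ s t → label P s i j ≡ a → label P t i j ≡ a →
  edgeColour P χ s i j ≡ edgeColour P χ t i j

-- This lets triples be settled one after another: `φ` keeps labels and `pullback` keeps colours, so
-- `P` inherits what is settled in `Q`.
LabelDetermines-pullback : ∀ {r M q} {P Q : System r M} (φ : P ⟶ Q) {χ : PairColouring Q q} {i j a} →
  LabelDetermines Q χ i j a → LabelDetermines P (pullback φ χ) i j a
LabelDetermines-pullback {P = P} {Q} φ {χ} {i} {j} det s t s≡a t≡a =
  trans (sym (colour s)) (trans
    (det (copy φ s) (copy φ t) (trans (label-copy φ s i j) s≡a) (trans (label-copy φ t i j) t≡a))
    (colour t))
  where
  colour : ∀ s → edgeColour Q χ (copy φ s) i j ≡ edgeColour P (pullback φ χ) s i j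
  colour s = cong₂ (χ i j) (vertex-copy φ i s) (vertex-copy φ j s)

id⟶ : ∀ {r M} (P : System r M) → P ⟶ P
id⟶ P = record { copy = id ; vert = λ _ → id ; vertex-copy = λ _ _ → refl ; label-copy = λ _ _ _ → refl }

_∘⟶_ : ∀ {r M} {P Q R : System r M} → Q ⟶ R → P ⟶ Q → P ⟶ R
φ ∘⟶ ψ = record
  { copy        = copy φ ∘ copy ψ
  ; vert        = λ k → vert φ k ∘ vert ψ k
  ; vertex-copy = λ k s → trans (vertex-copy φ k (copy ψ s)) (cong (vert φ k) (vertex-copy ψ k s))
  ; label-copy  = λ s i j → trans (label-copy φ (copy ψ s) i j) (label-copy ψ s i j)
  }

-- One amalgamation step of the partite construction, for the parts i, j and the label of s₀ at ij.
-- The new vertices of parts i and j are N-tuples of old ones; every combinatorial line over the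
-- old copies is a homomorphic image of P which keeps the other parts to itself.
module Amalgamation {r M} (P : System r M) {i j : Fin r} (i≢j : i ≢ j) (s₀ : Copy P) (N : ℕ) where

  -- The first component is a coordinate forced to move.
  Line : Set
  Line = Fin N × Vec (Copy P ⊎ Fin 1) N

  LabelledLike-s₀ : Copy P → Set
  LabelledLike-s₀ s = label P s i j ≡ label P s₀ i j

  clamp′ : ∀ s → Dec (LabelledLike-s₀ s) → Copy P
  clamp′ s (yes _) = s
  clamp′ s (no  _) = s₀

  -- A retraction onto the copies labelled like `s₀` at `i`, `j`, with `s₀` as default. It lets the
  -- cube have alphabet `Copy P`, although only those copies act as letters.
  clamp : Copy P → Copy P
  clamp s = clamp′ s (label P s i j ≟ label P s₀ i j)

  clamp-label : ∀ s → LabelledLike-s₀ (clamp s)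
  clamp-label s = go (label P s i j ≟ label P s₀ i j)
    where
    go : ∀ d → LabelledLike-s₀ (clamp′ s d)
    go (yes eq) = eq
    go (no  _)  = refl

  clamp-fixes : ∀ {s} → LabelledLike-s₀ s → clamp s ≡ s
  clamp-fixes {s} eq with label P s i j ≟ label P s₀ i j
  ... | yes _  = refl
  ... | no  ne = contradiction eq ne

  -- Overwriting the distinguished coordinate and clamping constants makes every element of `Line` a
  -- genuine line whose constants have the label of `s₀`.
  slot′ : ∀ {x x₀ : Fin N} → Dec (x ≡ x₀) → Copy P ⊎ Fin 1 → Copy P ⊎ Fin 1
  slot′ (yes _) z = inj₂ zero
  slot′ (no  _) z = Sum.map₁ clamp z

  slot : Line → Fin N → Copy P ⊎ Fin 1
  slot (x₀ , L) x = slot′ (x ≟ x₀) (lookup L x)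

  slot-moves : ∀ L → slot L (proj₁ L) ≡ inj₂ zero
  slot-moves (x₀ , L) with x₀ ≟ x₀
  ... | yes _     = refl
  ... | no  x₀≢x₀ = contradiction refl x₀≢x₀

  point : Line → Copy P → Fin N → Copy P
  point L s x = [ id , const s ]′ (slot L x)

  pointVertex : Fin r → Line → Vertex P → Fin N → Vertex P
  pointVertex k L u x = [ vertex P k , const u ]′ (slot L x)

  vertex-point : ∀ k L s x → vertex P k (point L s x) ≡ pointVertex k L (vertex P k s) x
  vertex-point k L s x with slot L x
  ... | inj₁ _ = refl
  ... | inj₂ _ = refl

  point-moves : ∀ L s → point L s (proj₁ L) ≡ s
  point-moves L s = cong [ id , const s ]′ (slot-moves L)

  pointVertex-moves : ∀ k L u → pointVertex k L u (proj₁ L) ≡ u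
  pointVertex-moves k L u = cong [ vertex P k , const u ]′ (slot-moves L)

  -- A moving coordinate shows `s` itself; a fixed one shows a clamped copy.
  point-label : ∀ L s x → label P (point L s x) i j ≡ label P s i j ⊎ LabelledLike-s₀ (point L s x)
  point-label (x₀ , L) s x = go (x ≟ x₀) (lookup L x)
    where
    go : ∀ d z → let p = [ id , const s ]′ (slot′ {x} {x₀} d z) in
      label P p i j ≡ label P s i j ⊎ LabelledLike-s₀ p
    go (yes _) z        = inj₁ refl
    go (no  _) (inj₁ t) = inj₂ (clamp-label t)
    go (no  _) (inj₂ _) = inj₁ refl

  -- Evaluating at a moving coordinate of either line shows that the two labels agree or are
  -- both the label of s₀.
  points-agree⇒label≡ : ∀ {L L′ s t} →
    (∀ x → label P (point L s x) i j ≡ label P (point L′ t x) i j) → label P s i j ≡ label P t i j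
  points-agree⇒label≡ {L} {L′} {s} {t} agree = compare (point-label L′ t x) (point-label L s x′)
    where
    labelᵢⱼ : Copy P → Fin M
    labelᵢⱼ p = label P p i j
    x x′ : Fin N
    x  = proj₁ L
    x′ = proj₁ L′
    s-at-x : labelᵢⱼ s ≡ labelᵢⱼ (point L′ t x)
    s-at-x = trans (cong labelᵢⱼ (sym (point-moves L s))) (agree x)
    t-at-x′ : labelᵢⱼ (point L s x′) ≡ labelᵢⱼ t
    t-at-x′ = trans (agree x′) (cong labelᵢⱼ (point-moves L′ t))
    compare : labelᵢⱼ (point L′ t x) ≡ labelᵢⱼ t ⊎ LabelledLike-s₀ (point L′ t x) →
      labelᵢⱼ (point L s x′) ≡ labelᵢⱼ s ⊎ LabelledLike-s₀ (point L s x′) → labelᵢⱼ s ≡ labelᵢⱼ t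
    compare (inj₁ t-moves) _              = trans s-at-x t-moves
    compare (inj₂ _)       (inj₁ s-moves) = trans (sym s-moves) t-at-x′
    compare (inj₂ t≡s₀)    (inj₂ s≡s₀)    =
      trans (trans s-at-x t≡s₀) (sym (trans (sym t-at-x′) s≡s₀))

  Vertex′ : Set
  Vertex′ = (Line × Vertex P) ⊎ Vec (Vertex P) N

  place′ : ∀ k → Dec (k ≡ i ⊎ k ≡ j) → Line → Vertex P → Vertex′
  place′ k (yes _) L u = inj₂ (tabulate (pointVertex k L u))
  place′ k (no  _) L u = inj₁ (L , u)

  active? : ∀ k → Dec (k ≡ i ⊎ k ≡ j)
  active? k = (k ≟ i) ⊎-dec (k ≟ j)

  place : ∀ k → Line → Vertex P → Vertex′
  place k = place′ k (active? k)

  place-active : ∀ {k} → k ≡ i ⊎ k ≡ j → ∀ L u → place k L u ≡ inj₂ (tabulate (pointVertex k L u))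
  place-active {k} active L u with active? k
  ... | yes _       = refl
  ... | no inactive = contradiction active inactive

  tabulate-injective : ∀ {A : Set} {n} {f g : Fin n → A} → tabulate f ≡ tabulate g → f ≗ g
  tabulate-injective {f = f} {g} eq x = trans (sym (lookup∘tabulate f x))
    (trans (cong (λ v → lookup v x) eq) (lookup∘tabulate g x))

  -- In an active part, the moving coordinate of the tuple recovers the vertex.
  place′-injective : ∀ {k} d {L u v} → place′ k d L u ≡ place′ k d L v → u ≡ v
  place′-injective {k} (yes _) {L} {u} {v} eq = trans (sym (pointVertex-moves k L u))
    (trans (tabulate-injective (inj₂-injective eq) (proj₁ L)) (pointVertex-moves k L v))
  place′-injective (no _) refl = refl

  points-agree : ∀ {L L′ s t} k d → place′ k (yes d) L (vertex P k s) ≡ place′ k (yes d) L′ (vertex P k t) →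
    ∀ x → vertex P k (point L s x) ≡ vertex P k (point L′ t x)
  points-agree {L} {L′} {s} {t} k _ eq x = trans (vertex-point k L s x)
    (trans (tabulate-injective (inj₂-injective eq) x) (sym (vertex-point k L′ t x)))

  -- A shared vertex in an inactive part records its line, so both copies lie in one image of `P`.
  -- If both parts are active, the two points have the same vertices at every coordinate, where
  -- `consistent P` applies.
  place′-consistent : ∀ {L L′ s t k l} d e → k ≢ l →
    place′ k d L (vertex P k s) ≡ place′ k d L′ (vertex P k t) →
    place′ l e L (vertex P l s) ≡ place′ l e L′ (vertex P l t) →
    label P s k l ≡ label P t k l
  place′-consistent {L} {L′} {s} {t} {k} {l} (no _) e k≢l eqₖ eqₗ
    with refl ← cong proj₁ (inj₁-injective eqₖ)
    = consistent P k≢l (cong proj₂ (inj₁-injective eqₖ)) (place′-injective e eqₗ)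
  place′-consistent {L} d@(yes _) (no _) k≢l eqₖ eqₗ
    with refl ← cong proj₁ (inj₁-injective eqₗ)
    = consistent P k≢l (place′-injective d {L} eqₖ) (cong proj₂ (inj₁-injective eqₗ))
  place′-consistent {L} {L′} {s} {t} (yes k∈ij) (yes l∈ij) k≢l eqₖ eqₗ with k∈ij | l∈ij
  ... | inj₁ refl | inj₁ refl = contradiction refl k≢l
  ... | inj₂ refl | inj₂ refl = contradiction refl k≢l
  ... | inj₁ refl | inj₂ refl = points-agree⇒label≡ {L} {L′} λ x → consistent P i≢j
    (points-agree {L} {L′} i k∈ij eqₖ x) (points-agree {L} {L′} j l∈ij eqₗ x)
  ... | inj₂ refl | inj₁ refl = trans (label-sym P s j i) (trans
    (points-agree⇒label≡ {L} {L′} λ x → consistent P i≢j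
      (points-agree {L} {L′} i l∈ij eqₗ x) (points-agree {L} {L′} j k∈ij eqₖ x))
    (label-sym P t i j))

  lineFinite : Finite Line
  lineFinite = ×-finite (N , ↔-refl) (Vec-finite N (⊎-finite (copyFinite P) (1 , ↔-refl)))

  amalgam : System r M
  amalgam = record
    { Copy         = Line × Copy P
    ; Vertex       = Vertex′
    ; copyFinite   = ×-finite lineFinite (copyFinite P)
    ; vertexFinite = ⊎-finite (×-finite lineFinite (vertexFinite P)) (Vec-finite N (vertexFinite P))
    ; vertex       = λ k (L , s) → place k L (vertex P k s)
    ; label        = λ (_ , s) → label P s
    ; label-sym    = λ (_ , s) → label-sym P s
    ; consistent   = λ {_} {_} {k} {l} → place′-consistent (active? k) (active? l)
    }

  inclusion : Line → P ⟶ amalgam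
  inclusion L = record
    { copy        = L ,_
    ; vert        = λ k → place k L
    ; vertex-copy = λ _ _ → refl
    ; label-copy  = λ _ _ _ → refl
    }

  module _ {q} (χ : PairColouring amalgam q) where

    tupleVertex : Fin r → Vec (Copy P) N → Vertex′
    tupleVertex k v = inj₂ (map (vertex P k) v)

    -- A word names one tuple in part `i` and one in part `j`; clamping turns every word into one
    -- whose letters are labelled like `s₀`.
    wordColour : Vec (Copy P) N → Fin q
    wordColour v = χ i j (tupleVertex i (map clamp v)) (tupleVertex j (map clamp v))

    -- `clamp` fixes `s`, so the endpoints of this edge are exactly the two tuples named by the word
    -- `L ⟨ s ⟩`.
    line-edgeColour : ∀ L x₀ → lookup L x₀ ≡ inj₂ zero → ∀ s → LabelledLike-s₀ s →
      edgeColour amalgam χ ((x₀ , L) , s) i j ≡ wordColour (L ⟨ s ⟩)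
    line-edgeColour L x₀ move s s≡s₀ = cong₂ (χ i j) (at i (inj₁ refl)) (at j (inj₂ refl))
      where
      coordinate : ∀ k x → pointVertex k (x₀ , L) (vertex P k s) x ≡
        vertex P k (clamp ([ id , lookup (s ∷ []) ]′ (lookup L x)))
      coordinate k x with x ≟ x₀
      -- `slot` overwrites coordinate `x₀`, and by `move` the template `L` moves there too.
      ... | yes refl rewrite move = cong (vertex P k) (sym (clamp-fixes s≡s₀))
      ... | no  _ with lookup L x
      ...   | inj₁ _    = refl
      ...   | inj₂ zero = cong (vertex P k) (sym (clamp-fixes s≡s₀))
      at : ∀ k → k ≡ i ⊎ k ≡ j → place k (x₀ , L) (vertex P k s) ≡ tupleVertex k (map clamp (L ⟨ s ⟩))
      at k active = trans (place-active active (x₀ , L) (vertex P k s)) (cong inj₂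
        (trans (tabulate-cong (λ x → trans (coordinate k x) (sym (lookup-maps k x))))
          (tabulate∘lookup _)))
        where
        lookup-maps : ∀ k x → lookup (map (vertex P k) (map clamp (L ⟨ s ⟩))) x ≡
          vertex P k (clamp ([ id , lookup (s ∷ []) ]′ (lookup L x)))
        lookup-maps k x = trans (lookup-map x _ (map clamp (L ⟨ s ⟩))) (cong (vertex P k)
          (trans (lookup-map x clamp (L ⟨ s ⟩)) (cong clamp (lookup-map x _ L))))

hales-jewett-finite : ∀ {A} → Finite A → ∀ q → ∃[ N ] ∀ (χ : Vec A N → Fin q) →
  ∃[ L ] (∃[ x ] lookup L x ≡ inj₂ zero) × (∀ a b → χ (L ⟨ a ⟩) ≡ χ (L ⟨ b ⟩))
hales-jewett-finite {A} (s , f) q with N , line ← hales-jewett s q = N , go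
  where
  open Inverse f
  go : ∀ (χ : Vec A N → Fin q) →
    ∃[ L ] (∃[ x ] lookup L x ≡ inj₂ zero) × (∀ a b → χ (L ⟨ a ⟩) ≡ χ (L ⟨ b ⟩))
  go χ with L , (x , move) , mono ← line (χ ∘ map from)
    = map (Sum.map₁ from) L , (x , trans (lookup-map x _ L) (cong (Sum.map₁ from) move)) ,
      λ a b → trans (colour a) (trans (mono (to a) (to b)) (sym (colour b)))
    where
    colour : ∀ a → χ (map (Sum.map₁ from) L ⟨ a ⟩) ≡ χ (map from (L ⟨ to a ⟩))
    colour a = cong χ (trans (sym (map-∘ _ _ L)) (trans (map-cong pointwise L) (map-∘ _ _ L)))
      where
      pointwise : ∀ z → [ id , lookup (a ∷ []) ]′ (Sum.map₁ from z) ≡ from ([ id , lookup (to a ∷ []) ]′ z)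
      pointwise (inj₁ _)    = refl
      pointwise (inj₂ zero) = sym (strictlyInverseʳ a)

Arrows : ∀ {r M} → ℕ → (Fin r → Fin r → Fin M → Set) → System r M → System r M → Set
Arrows q T P Q = ∀ (χ : PairColouring Q q) →
  Σ[ φ ∈ P ⟶ Q ] (∀ {i j a} → T i j a → LabelDetermines P (pullback φ χ) i j a)

-- A line monochromatic for `wordColour` is an image of `P` in which the edges with label `a`
-- between parts `i` and `j` are points of the line. If no copy has this label there, `P` itself
-- works vacuously.
arrows-single : ∀ {r M} q (P : System r M) i j a → i ≢ j →
  Σ[ Q ∈ System r M ] ∀ (χ : PairColouring Q q) →
    Σ[ φ ∈ P ⟶ Q ] LabelDetermines P (pullback φ χ) i j a
arrows-single {r} {M} q P i j a i≢j with search (copyFinite P) (λ s → label P s i j ≟ a)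
... | no none = P , λ χ → id⟶ P , λ s t s≡a _ → contradiction (s , s≡a) none
... | yes (s₀ , refl) with N , line ← hales-jewett-finite (copyFinite P) q = amalgam , go
  where
  open Amalgamation P i≢j s₀ N
  go : ∀ (χ : PairColouring amalgam q) →
    Σ[ φ ∈ P ⟶ amalgam ] LabelDetermines P (pullback φ χ) i j (label P s₀ i j)
  go χ with L , (x , move) , mono ← line (wordColour χ) = inclusion (x , L) , λ s t s≡s₀ t≡s₀ →
    trans (line-edgeColour χ L x move s s≡s₀) (trans (mono s t) (sym (line-edgeColour χ L x move t t≡s₀)))

-- The system is built from the head of the list on, but a colouring is treated in reverse: first
-- pass to an image of `P′` good for the tail, then to an image of `P` inside it good for the head.
arrows-list : ∀ {r M} q (ts : List (Fin r × Fin r × Fin M)) (P : System r M) →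
  Σ[ Q ∈ System r M ] Arrows q (λ i j a → i ≢ j × (i , j , a) ∈ₗ ts) P Q
arrows-list q [] P = P , λ χ → id⟶ P , λ ()
arrows-list q ((i , j , a) ∷ ts) P with i ≟ j
... | yes refl with Q , arrows ← arrows-list q ts P = Q , λ χ → let φ , det = arrows χ in φ ,
  λ { (i≢i , here refl) → contradiction refl i≢i ; (i≢j , there t∈ts) → det (i≢j , t∈ts) }
... | no i≢j
  with P′ , single ← arrows-single q P i j a i≢j
  with Q  , arrows ← arrows-list q ts P′
  = Q , λ χ →
    let ψ , det = arrows χ ; φ , det₁ = single (pullback ψ χ) in
    ψ ∘⟶ φ ,
    λ { (_ , here refl) → det₁
      ; (i≢j , there t∈ts) → LabelDetermines-pullback φ {pullback ψ χ} (det (i≢j , t∈ts)) }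

abstract

  arrows-all : ∀ {r M} q (P : System r M) → Σ[ Q ∈ System r M ] Arrows q (λ i j a → i ≢ j) P Q
  arrows-all {r} {M} q P
    with Q , arrows ← arrows-list q (cartesianProduct (allFin r) (cartesianProduct (allFin r) (allFin M))) P
    = Q , λ χ → let φ , det = arrows χ in φ , λ i≢j → det (i≢j ,
      ∈-cartesianProduct⁺ (∈-allFin _) (∈-cartesianProduct⁺ (∈-allFin _) (∈-allFin _)))

-- From systems to graphs

module SystemGraph {r M} (P : System r M) where

  Node : Set
  Node = Fin r × Vertex P

  nodeFinite : Finite Node
  nodeFinite = ×-finite (r , ↔-refl) (vertexFinite P)

  open Inverse (proj₂ nodeFinite) using (to; from; strictlyInverseʳ)

  Edge : Node → Node → Set
  Edge (k , u) (l , v) = k ≢ l × ∃[ s ] vertex P k s ≡ u × vertex P l s ≡ v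

  edge? : ∀ x y → Dec (Edge x y)
  edge? (k , u) (l , v) = ¬? (k ≟ l) ×-dec search (copyFinite P)
    (λ s → finite⇒≟ (vertexFinite P) (vertex P k s) u ×-dec finite⇒≟ (vertexFinite P) (vertex P l s) v)

  -- The label is read from whichever copy the search returns; `consistent` makes it independent of
  -- this choice.
  edgeLabel : ∀ {x y} → Dec (Edge x y) → Maybe (Fin M)
  edgeLabel {k , _} {l , _} (yes (_ , s , _)) = just (label P s k l)
  edgeLabel                 (no _)            = nothing

  edgeLabel-sym : ∀ {x y} (d : Dec (Edge x y)) (e : Dec (Edge y x)) → edgeLabel d ≡ edgeLabel e
  edgeLabel-sym {k , _} {l , _} (yes (k≢l , s , su , sv)) (yes (_ , t , tv , tu)) = cong just
    (trans (consistent P k≢l (trans su (sym tu)) (trans sv (sym tv))) (label-sym P t k l))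
  edgeLabel-sym (yes (k≢l , s , su , sv)) (no ¬e) = contradiction (k≢l ∘ sym , s , sv , su) ¬e
  edgeLabel-sym (no ¬d) (yes (l≢k , t , tv , tu)) = contradiction (l≢k ∘ sym , t , tu , tv) ¬d
  edgeLabel-sym (no _)  (no _) = refl

  edgeLabel-irrefl : ∀ {x} (d : Dec (Edge x x)) → edgeLabel d ≡ nothing
  edgeLabel-irrefl (yes (k≢k , _)) = contradiction refl k≢k
  edgeLabel-irrefl (no _)          = refl

  graph : LGraph (Fin M)
  graph = record
    { N          = proj₁ nodeFinite
    ; lab        = λ u v → edgeLabel (edge? (from u) (from v))
    ; lab-sym    = λ u v → edgeLabel-sym (edge? (from u) (from v)) (edge? (from v) (from u))
    ; lab-irrefl = λ u → edgeLabel-irrefl (edge? (from u) (from u))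
    }

  node : Fin r → Vertex P → Fin (N graph)
  node k u = to (k , u)

  lab-copy : ∀ s {k l} → k ≢ l →
    lab graph (node k (vertex P k s)) (node l (vertex P l s)) ≡ just (label P s k l)
  lab-copy s {k} {l} k≢l =
    trans (cong₂ (λ x y → edgeLabel (edge? x y)) (strictlyInverseʳ _) (strictlyInverseʳ _)) (go (edge? _ _))
    where
    go : (d : Dec (Edge (k , vertex P k s) (l , vertex P l s))) → edgeLabel d ≡ just (label P s k l)
    go (yes (_ , t , tu , tv)) = cong just (consistent P k≢l tu tv)
    go (no ¬e)                 = contradiction (k≢l , s , refl , refl) ¬e

-- Stored by rows, from the diagonal on.
SymMatrix : ℕ → ℕ → Set
SymMatrix M zero    = Vec (Fin M) 0
SymMatrix M (suc r) = Vec (Fin M) (suc r) × SymMatrix M r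

entry : ∀ {M r} → SymMatrix M r → Fin r → Fin r → Fin M
entry (row , A) zero    j       = lookup row j
entry (row , A) (suc i) zero    = lookup row (suc i)
entry (row , A) (suc i) (suc j) = entry A i j

entry-sym : ∀ {M r} (A : SymMatrix M r) i j → entry A i j ≡ entry A j i
entry-sym (row , A) zero    zero    = refl
entry-sym (row , A) zero    (suc j) = refl
entry-sym (row , A) (suc i) zero    = refl
entry-sym (row , A) (suc i) (suc j) = entry-sym A i j

symMatrix : ∀ {M} r → (Fin r → Fin r → Fin M) → SymMatrix M r
symMatrix zero    f = []
symMatrix (suc r) f = tabulate (f zero) , symMatrix r (λ i j → f (suc i) (suc j))

entry-symMatrix : ∀ {M} r (f : Fin r → Fin r → Fin M) → (∀ i j → f i j ≡ f j i) →
  ∀ i j → entry (symMatrix r f) i j ≡ f i j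
entry-symMatrix (suc r) f f-sym zero    j       = lookup∘tabulate (f zero) j
entry-symMatrix (suc r) f f-sym (suc i) zero    =
  trans (lookup∘tabulate (f zero) (suc i)) (f-sym zero (suc i))
entry-symMatrix (suc r) f f-sym (suc i) (suc j) =
  entry-symMatrix r (λ i j → f (suc i) (suc j)) (λ i j → f-sym (suc i) (suc j)) i j

symMatrixFinite : ∀ M r → Finite (SymMatrix M r)
symMatrixFinite M zero    = Vec-finite 0 (M , ↔-refl)
symMatrixFinite M (suc r) = ×-finite (Vec-finite (suc r) (M , ↔-refl)) (symMatrixFinite M r)

-- Each copy serves as its own vertex in every part, so the copies are disjoint and a shared vertex
-- forces equal copies.
allLabellings : ∀ r M → System r M
allLabellings r M = record
  { Copy         = SymMatrix M r
  ; Vertex       = SymMatrix M r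
  ; copyFinite   = symMatrixFinite M r
  ; vertexFinite = symMatrixFinite M r
  ; vertex       = λ _ A → A
  ; label        = entry
  ; label-sym    = entry-sym
  ; consistent   = λ { _ refl _ → refl }
  }

-- Used to spread a labelling of `suc n` chosen parts over all `r` parts; parts outside the range of
-- `g` go to `zero`.
leftInverse : ∀ {n r} (g : Fin (suc n) → Fin r) → (∀ {i j} → i ≢ j → g i ≢ g j) →
  Σ[ h ∈ (Fin r → Fin (suc n)) ] h ∘ g ≗ id
leftInverse {n} {r} g g-≢ = (λ x → choose (any? (λ i → g i ≟ x))) ,
  λ i → choose-g i (any? (λ j → g j ≟ g i))
  where
  choose : ∀ {x} → Dec (∃ λ i → g i ≡ x) → Fin (suc n)
  choose (yes (i , _)) = i
  choose (no _)        = zero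
  choose-g : ∀ i (d : Dec (∃ λ j → g j ≡ g i)) → choose d ≡ i
  choose-g i (yes (j , gj≡gi)) with j ≟ i
  ... | yes j≡i = j≡i
  ... | no  j≢i = contradiction gj≡gi (g-≢ j≢i)
  choose-g i (no none) = contradiction (i , refl) none

-- Removing the dependence on the parts

nodeColouring : ∀ {r M q} (Q : System r M) → let open SystemGraph Q in
  (Fin (N graph) → Fin (N graph) → Fin q) → PairColouring Q q
nodeColouring Q χ i j u v = χ (node i u) (node j v)
  where open SystemGraph Q

constantMatrix : ∀ {M} r → Fin M → SymMatrix M r
constantMatrix r a = symMatrix r (λ _ _ → a)

-- Once the label determines the colour between two parts, that colour can be read from the copy all
-- of whose labels are `a`.
constantColour : ∀ {q r M} → PairColouring (allLabellings r M) q → Fin r → Fin r → Fin M → Fin q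
constantColour {r = r} {M} χ i j a = edgeColour (allLabellings r M) χ (constantMatrix r a) i j

LabelColoured : ∀ {M q} (G : LGraph (Fin M)) → Colouring G q → ℕ → Set
LabelColoured {M} {q} G χ n = Σ[ c ∈ (Fin M → Fin q) ]
  ∀ (ℓ : Fin n → Fin n → Fin M) → (∀ i j → ℓ i j ≡ ℓ j i) →
    Σ[ f ∈ (Fin n → Fin (N G)) ]
      (∀ i j → i ≢ j → lab G (f i) (f j) ≡ just (ℓ i j) × proj₁ χ (f i) (f j) ≡ c (ℓ i j))

module _ {q r M} (Q : System r M) (χ : Colouring (SystemGraph.graph Q) q)
  (φ : allLabellings r M ⟶ Q) where

  open SystemGraph Q

  χ₀ : PairColouring (allLabellings r M) q
  χ₀ = pullback φ (nodeColouring Q (proj₁ χ))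

  module _ {n} (det : ∀ {i j a} → i ≢ j → LabelDetermines (allLabellings r M) χ₀ i j a)
    {g : Fin (suc n) → Fin r} (g-mono : StrictMono g) (c : Fin (q ^ M))
    (mono : ∀ {i j} → i F.< j → funToFin (constantColour χ₀ (g i) (g j)) ≡ c) where

    -- The hypothesis `mono` covers `i < j`; the other order follows by symmetry of `χ`, as the same
    -- constant copy is read in both.
    constantColour≡ : ∀ a {i j} → i ≢ j → constantColour χ₀ (g i) (g j) a ≡ finToFun c a
    constantColour≡ a {i} {j} i≢j with ℕ.<-cmp (toℕ i) (toℕ j)
    ... | tri< i<j _ _ = trans (sym (finToFun-funToFin _ a)) (cong (λ d → finToFun d a) (mono i<j))
    ... | tri≈ _ i≡j _ = contradiction (toℕ-injective i≡j) i≢j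
    ... | tri> _ _ j<i = trans (proj₂ χ _ _)
      (trans (sym (finToFun-funToFin _ a)) (cong (λ d → finToFun d a) (mono j<i)))

    module _ (ℓ : Fin (suc n) → Fin (suc n) → Fin M) (ℓ-sym : ∀ i j → ℓ i j ≡ ℓ j i)
      (h : Fin r → Fin (suc n)) (h∘g : h ∘ g ≗ id) where

      matrix : SymMatrix M r
      matrix = symMatrix r (λ x y → ℓ (h x) (h y))

      matrix-entry : ∀ i j → entry matrix (g i) (g j) ≡ ℓ i j
      matrix-entry i j =
        trans (entry-symMatrix r _ (λ x y → ℓ-sym (h x) (h y)) (g i) (g j)) (cong₂ ℓ (h∘g i) (h∘g j))

      embedding : Fin (suc n) → Fin (N graph)
      embedding i = node (g i) (vert φ (g i) matrix)

      lab-embedding : ∀ i j → i ≢ j → lab graph (embedding i) (embedding j) ≡ just (ℓ i j)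
      lab-embedding i j i≢j = trans
        (cong₂ (λ u v → lab graph (node (g i) u) (node (g j) v))
          (sym (vertex-copy φ (g i) matrix)) (sym (vertex-copy φ (g j) matrix)))
        (trans (lab-copy (copy φ matrix) (strictMono⇒≢ g-mono i≢j))
          (cong just (trans (label-copy φ matrix (g i) (g j)) (matrix-entry i j))))

      -- The copy of `matrix` may be exchanged for a constant one, since both have label `ℓ i j`
      -- between these two parts.
      colour-embedding : ∀ i j → i ≢ j → proj₁ χ (embedding i) (embedding j) ≡ finToFun c (ℓ i j)
      colour-embedding i j i≢j = trans
        (det (strictMono⇒≢ g-mono i≢j) matrix (constantMatrix r (ℓ i j)) (matrix-entry i j)
          (entry-symMatrix r _ (λ _ _ → refl) (g i) (g j)))
        (constantColour≡ (ℓ i j) i≢j)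

    labelColoured : LabelColoured graph χ (suc n)
    labelColoured = finToFun c , λ ℓ ℓ-sym →
      embedding ℓ ℓ-sym h h∘g , λ i j i≢j →
        lab-embedding ℓ ℓ-sym h h∘g i j i≢j , colour-embedding ℓ ℓ-sym h h∘g i j i≢j
      where
      h : Fin r → Fin (suc n)
      h = proj₁ (leftInverse g (strictMono⇒≢ g-mono))
      h∘g : h ∘ g ≗ id
      h∘g = proj₂ (leftInverse g (strictMono⇒≢ g-mono))

abstract

  label-ramsey : ∀ q n M → ∃[ G ] ∀ (χ : Colouring {Fin M} G q) → LabelColoured G χ (suc n)
  -- A pair of parts is coloured by a function from `M` labels to `q` colours, whence `q ^ M`.
  label-ramsey q n M = build (ramsey (q ^ M) n)
    where
    Clique : ℕ → Set
    Clique R = ∀ (κ : Fin R → Fin R → Fin (q ^ M)) →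
      ∃[ g ] StrictMono {suc n} g × ∃[ c ] (∀ {i j} → i F.< j → κ (g i) (g j) ≡ c)

    fromArrow : ∀ {r} → Clique r → (Q : System r M) (χ : Colouring (SystemGraph.graph Q) q) →
      Σ[ φ ∈ allLabellings r M ⟶ Q ]
        (∀ {i j a} → i ≢ j → LabelDetermines (allLabellings r M) (χ₀ Q χ φ) i j a) →
      LabelColoured (SystemGraph.graph Q) χ (suc n)
    fromArrow clique Q χ (φ , det) = fromClique (clique (λ i j → funToFin (constantColour (χ₀ Q χ φ) i j)))
      where
      fromClique : ∃[ g ] StrictMono {suc n} g × ∃[ c ] (∀ {i j} → i F.< j →
        funToFin (constantColour (χ₀ Q χ φ) (g i) (g j)) ≡ c) →
        LabelColoured (SystemGraph.graph Q) χ (suc n)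
      fromClique (g , g-mono , c , mono) = labelColoured Q χ φ det g-mono c mono

    fromSystem : ∀ {r} → Clique r → Σ[ Q ∈ System r M ] Arrows q (λ i j a → i ≢ j) (allLabellings r M) Q →
      ∃[ G ] ∀ (χ : Colouring {Fin M} G q) → LabelColoured G χ (suc n)
    fromSystem clique (Q , arrows) = SystemGraph.graph Q ,
      λ χ → fromArrow clique Q χ (arrows (nodeColouring Q (proj₁ χ)))

    build : ∃[ R ] Clique (suc R) → ∃[ G ] ∀ (χ : Colouring {Fin M} G q) → LabelColoured G χ (suc n)
    build (R , clique) = fromSystem clique (arrows-all q (allLabellings (suc R) M))

-- Pigeonhole on the labels

labelled⇒injective : ∀ {n} {L : Set} (G : LGraph L) (f : Fin n → Fin (N G)) (ℓ : Fin n → Fin n → L) →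
  (∀ i j → i ≢ j → lab G (f i) (f j) ≡ just (ℓ i j)) → Injective _≡_ _≡_ f
labelled⇒injective G f ℓ labels {i} {j} fi≡fj with i ≟ j
... | yes i≡j = i≡j
... | no  i≢j with () ← trans (sym (labels i j i≢j))
                          (trans (cong (lab G (f i)) (sym fi≡fj)) (lab-irrefl G (f i)))

-- When the colour is a function of the label, `q * (m ∸ 1) + 1` labels include `m` of one colour;
-- these form `S`.
monochromaticLabels : ∀ (q n m : ℕ) → 2 ≤ q → 2 ≤ n → 2 ≤ m →
  ∃[ G ] ∀ (χ : Colouring {Fin (q * (m ∸ 1) + 1)} G q) →
    ∃[ S ] ∃[ c ] ∣ S ∣ ≡ m ×
      ((ℓ : KLabelling n (q * (m ∸ 1) + 1) S) → MonoLabeledCopy G (Σ.proj₁ χ) c (Σ.proj₁ ℓ))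
monochromaticLabels q (suc n) (suc m) _ _ _ with G , ramseyG ← label-ramsey q n (q * m + 1) = G , go
  where
  go : ∀ (χ : Colouring {Fin (q * m + 1)} G q) →
    ∃[ S ] ∃[ c ] ∣ S ∣ ≡ suc m ×
      ((ℓ : KLabelling (suc n) (q * m + 1) S) → MonoLabeledCopy G (Σ.proj₁ χ) c (Σ.proj₁ ℓ))
  go χ
    with colour , copies ← ramseyG χ
    with S , size , c , S-mono ← pigeonhole-subset m colour (ℕ.m<m+n (q * m) (s≤s z≤n))
    = S , c , size , λ (ℓ , ℓ-sym , ℓ∈S) → let f , isCopy = copies ℓ ℓ-sym in
      f , labelled⇒injective G f ℓ (λ i j i≢j → proj₁ (isCopy i j i≢j)) ,
      λ i j i≢j → proj₁ (isCopy i j i≢j) , trans (proj₂ (isCopy i j i≢j)) (S-mono (ℓ∈S i j i≢j))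

-- Integer labels

pairs : ∀ n → List (Fin n × Fin n)
pairs zero    = []
pairs (suc n) =
  List.map (λ j → zero , suc j) (allFin n) List.++ List.map (λ (i , j) → suc i , suc j) (pairs n)

-- Pascal's rule: of the pairs in `suc n` points, `n C 1` contain `zero` and `n C 2` do not.
length-pairs : ∀ n → length (pairs n) ≡ n C 2
length-pairs zero    = refl
length-pairs (suc n) = trans (length-++ (List.map _ (allFin n)))
  (trans (cong₂ _+_
    (trans (length-map _ (allFin n)) (trans (length-tabulate {n = n} id) (sym (nC1≡n n))))
    (trans (length-map _ (pairs n)) (length-pairs n)))
  (nCk+nC[k+1]≡[n+1]C[k+1] n 1))

∈-pairs : ∀ {n} {i j : Fin n} → i F.< j → (i , j) ∈ₗ pairs n
∈-pairs {suc n} {zero}  {suc j} _         = ∈-++⁺ˡ (∈-map⁺ _ (∈-allFin j))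
∈-pairs {suc n} {suc i} {suc j} (s≤s i<j) = ∈-++⁺ʳ (List.map _ (allFin n)) (∈-map⁺ _ (∈-pairs i<j))

module _ {A : Set} {P Q : A → Set} (P? : ∀ x → Dec (P x)) (Q? : ∀ x → Dec (Q x))
  (P⇒Q : ∀ {x} → P x → Q x) where

  length-filter-mono : ∀ xs → length (filter P? xs) ≤ length (filter Q? xs)
  length-filter-mono [] = z≤n
  length-filter-mono (x ∷ xs) with P? x | Q? x
  ... | yes _ | yes _ = s≤s (length-filter-mono xs)
  ... | yes p | no ¬q = contradiction (P⇒Q p) ¬q
  ... | no _  | yes _ = ℕ.m≤n⇒m≤1+n (length-filter-mono xs)
  ... | no _  | no _  = length-filter-mono xs

  length-filter-strict : ∀ {x xs} → x ∈ₗ xs → ¬ P x → Q x → length (filter P? xs) < length (filter Q? xs)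
  length-filter-strict {x} {_ ∷ xs} (here refl) ¬p q with P? x | Q? x
  ... | yes p | _     = contradiction p ¬p
  ... | no _  | yes _ = s≤s (length-filter-mono xs)
  ... | no _  | no ¬q = contradiction q ¬q
  length-filter-strict {xs = y ∷ xs} (there x∈xs) ¬p q with P? y | Q? y
  ... | yes _ | yes _ = s≤s (length-filter-strict x∈xs ¬p q)
  ... | yes p | no ¬q = contradiction (P⇒Q p) ¬q
  ... | no _  | yes _ = ℕ.m≤n⇒m≤1+n (length-filter-strict x∈xs ¬p q)
  ... | no _  | no _  = length-filter-strict x∈xs ¬p q

module _ {n} (H : EOGraph n) where

  IsLabel : ℤ → Set
  IsLabel a = ∃₂ λ i j → hlab H i j ≡ just a

  -- `Maybe.Any` excludes non-edges, so `rank` counts edges only.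
  Below : ℤ → Fin n × Fin n → Set
  Below a (i , j) = Maybe.Any (ℤ._< a) (hlab H i j)

  below? : ∀ a p → Dec (Below a p)
  below? a (i , j) = Maybe.dec (ℤ._<? a) (hlab H i j)

  rank : ℤ → ℕ
  rank a = length (filter (below? a) (pairs n))

  label-∈-pairs : ∀ {a} → IsLabel a → ∃[ p ] p ∈ₗ pairs n × hlab H (proj₁ p) (proj₂ p) ≡ just a
  label-∈-pairs (i , j , eq) with ℕ.<-cmp (toℕ i) (toℕ j)
  ... | tri< i<j _ _ = _ , ∈-pairs i<j , eq
  ... | tri> _ _ j<i = _ , ∈-pairs j<i , trans (hlab-sym H j i) eq
  ... | tri≈ _ i≡j _ with refl ← toℕ-injective i≡j
                     with () ← trans (sym eq) (hlab-irrefl H i)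

  not-below : ∀ {a p} → hlab H (proj₁ p) (proj₂ p) ≡ just a → ¬ Below a p
  not-below eq below with Maybe.just a<a ← subst (Maybe.Any _) eq below = ℤ.<-irrefl refl a<a

  -- An edge with label `a` is not below `a`, so at least one pair is left out of the count.
  rank<nC2 : ∀ {a} → IsLabel a → rank a < n C 2
  rank<nC2 {a} isLabel with p , p∈ , eq ← label-∈-pairs isLabel =
    subst (rank a <_) (length-pairs n) (filter-notAll (below? a) (pairs n) (lose p∈ (not-below eq)))

  -- An edge that carries `a` is counted for `a′` and not for `a`.
  rank-strict : ∀ {a a′} → IsLabel a → a ℤ.< a′ → rank a < rank a′
  rank-strict {a} {a′} isLabel a<a′ with p , p∈ , eq ← label-∈-pairs isLabel =
    length-filter-strict (below? a) (below? a′) (Maybe.map (λ b<a → ℤ.<-trans b<a a<a′)) p∈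
      (not-below eq) (subst (Maybe.Any (ℤ._< a′)) (sym eq) (Maybe.just a<a′))

  -- Junk value 0 for k ≥ m.
  toIndex : ∀ {m} → 0 < m → ℕ → Fin m
  toIndex {m} 0<m k with k <? m
  ... | yes k<m = fromℕ< k<m
  ... | no  _   = fromℕ< 0<m

  toℕ-toIndex : ∀ {m k} (0<m : 0 < m) → k < m → toℕ (toIndex 0<m k) ≡ k
  toℕ-toIndex {m} {k} 0<m k<m with k <? m
  ... | yes k<m = toℕ-fromℕ< k<m
  ... | no  k≮m = contradiction k<m k≮m

  -- `H` is completed to a labelled complete graph, so its non-edges need an index as well; they
  -- receive 0.
  rankIndex : 0 < n C 2 → Maybe ℤ → Fin (n C 2)
  rankIndex 0<nC2 (just a) = toIndex 0<nC2 (rank a)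
  rankIndex 0<nC2 nothing  = toIndex 0<nC2 0

  rankIndex-strict : ∀ {0<nC2 a a′} → IsLabel a → IsLabel a′ → a ℤ.< a′ →
    rankIndex 0<nC2 (just a) F.< rankIndex 0<nC2 (just a′)
  rankIndex-strict {0<nC2} a∈H a′∈H a<a′ = subst₂ _<_
    (sym (toℕ-toIndex 0<nC2 (rank<nC2 a∈H))) (sym (toℕ-toIndex 0<nC2 (rank<nC2 a′∈H)))
    (rank-strict a∈H a<a′)

-- Take `m` to be `n C 2`. An edge with label `a` is relabelled by the element of `S` in position
-- `rank a`, counting from 0 in increasing order.
orderedCopies : ∀ (q n : ℕ) → 2 ≤ q → 2 ≤ n → 2 ≤ n C 2 →
  ∃[ G ] ∀ (χ : Colouring {Fin (q * ((n C 2) ∸ 1) + 1)} G q) →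
    ∃[ c ] ((H : EOGraph n) → MonoOrderedCopy G (Σ.proj₁ χ) c H)
orderedCopies q n 2≤q 2≤n 2≤nC2
  with G , mono ← monochromaticLabels q n (n C 2) 2≤q 2≤n 2≤nC2 = G , go
  where
  0<nC2 : 0 < n C 2
  0<nC2 = ℕ.<-trans (s≤s z≤n) 2≤nC2
  go : ∀ (χ : Colouring {Fin (q * ((n C 2) ∸ 1) + 1)} G q) →
    ∃[ c ] ((H : EOGraph n) → MonoOrderedCopy G (Σ.proj₁ χ) c H)
  go χ
    with S , c , size , copies ← mono χ
    with e , e-mono , e∈S ← subst (λ m → ∃[ e ] StrictMono {m} e × (∀ i → e i ∈ S)) size (enumerate S)
    = c , copy-of
    where
    copy-of : ∀ (H : EOGraph n) → MonoOrderedCopy G (Σ.proj₁ χ) c H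
    copy-of H with f , f-inj , isCopy ← copies
        ( (λ i j → e (rankIndex H 0<nC2 (hlab H i j)))
        , (λ i j → cong (e ∘ rankIndex H 0<nC2) (hlab-sym H i j))
        , (λ i j _ → e∈S _) )
      = f , f-inj , edges , order
      where
      newLabel : ℤ → Fin (q * ((n C 2) ∸ 1) + 1)
      newLabel a = e (rankIndex H 0<nC2 (just a))
      edge≢ : ∀ {i j a} → hlab H i j ≡ just a → i ≢ j
      edge≢ {i} eq refl with () ← trans (sym eq) (hlab-irrefl H i)
      lab-edge : ∀ {i j a} → hlab H i j ≡ just a → lab G (f i) (f j) ≡ just (newLabel a)
      lab-edge {i} {j} eq =
        trans (proj₁ (isCopy i j (edge≢ eq))) (cong (just ∘ e ∘ rankIndex H 0<nC2) eq)
      edges : ∀ i j a → hlab H i j ≡ just a →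
        (∃[ b ] lab G (f i) (f j) ≡ just b) × (Σ.proj₁ χ (f i) (f j) ≡ c)
      edges i j a eq = (newLabel a , lab-edge eq) , proj₂ (isCopy i j (edge≢ eq))
      newLabel-strict : ∀ {a a′} → IsLabel H a → IsLabel H a′ → a ℤ.< a′ →
        toℕ (newLabel a) < toℕ (newLabel a′)
      newLabel-strict a∈H a′∈H a<a′ = e-mono (rankIndex-strict H {0<nC2} a∈H a′∈H a<a′)
      newLabel-≤ : ∀ {a a′} → IsLabel H a → IsLabel H a′ → a ℤ.≤ a′ →
        toℕ (newLabel a) ≤ toℕ (newLabel a′)
      newLabel-≤ {a} {a′} a∈H a′∈H a≤a′ with a ℤ.≟ a′
      ... | yes refl = ℕ.≤-refl
      ... | no  a≢a′ = ℕ.<⇒≤ (newLabel-strict a∈H a′∈H (ℤ.≤∧≢⇒< a≤a′ a≢a′))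
      order : ∀ i j i′ j′ a a′ b b′ → hlab H i j ≡ just a → hlab H i′ j′ ≡ just a′ →
        lab G (f i) (f j) ≡ just b → lab G (f i′) (f j′) ≡ just b′ → (a ℤ.≤ a′) ⇔ (toℕ b ≤ toℕ b′)
      order i j i′ j′ a a′ b b′ eq eq′ eqb eqb′
        with refl ← just-injective (trans (sym eqb) (lab-edge eq))
           | refl ← just-injective (trans (sym eqb′) (lab-edge eq′))
        = mk⇔ (newLabel-≤ a∈H a′∈H)
            -- By totality of the order: `a′ < a` would make `b′` strictly smaller than `b`.
            (λ b≤b′ → ℤ.≮⇒≥ λ a′<a → ℕ.<⇒≱ (newLabel-strict a′∈H a∈H a′<a) b≤b′)
        where
        a∈H : IsLabel H a
        a∈H = i , j , eq
        a′∈H : IsLabel H a′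
        a′∈H = i′ , j′ , eq′

theorem5 : (∀ (q n m : ℕ) → 2 ≤ q → 2 ≤ n → 2 ≤ m →
    ∃[ G ] ∀ (χ : Colouring {Fin (q * (m ∸ 1) + 1)} G q) →
    ∃[ S ] ∃[ c ] ∣ S ∣ ≡ m ×
    ((ℓ : KLabelling n (q * (m ∸ 1) + 1) S) →
    MonoLabeledCopy G (Σ.proj₁ χ) c (Σ.proj₁ ℓ)))
    ×
    (∀ (q n : ℕ) → 2 ≤ q → 2 ≤ n → 2 ≤ n C 2 →
    ∃[ G ] ∀ (χ : Colouring {Fin (q * ((n C 2) ∸ 1) + 1)} G q) →
    ∃[ c ] ((H : EOGraph n) → MonoOrderedCopy G (Σ.proj₁ χ) c H))
theorem5 = monochromaticLabels , orderedCopies
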